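{- For every positive integer $\ell$ there exists a graph $G$ having a spanning tree $T$ such that $\gamma_g(G)-\gamma_g(T)\ge \ell$.
   Context: Graphs are finite, simple and nonempty. A spanning tree of $G$ is a subgraph of $G$ that is a tree and has the same vertex set as $G$. For a vertex $v$, $N[v]$ is its closed neighborhood; a chosen vertex $v$ dominates all vertices of $N[v]$. The domination game on a graph $G$ is played by two players, Dominator and Staller, who alternately choose vertices of $G$; each chosen vertex must dominate at least one vertex that was not dominated by the previously chosen vertices. The game ends when all vertices of $G$ are dominated. Dominator wants the total number of chosen vertices to be as small as possible, Staller wants it to be as large as possible. The game domination number $\gamma_g(G)$ is the total number of vertices chosen (by both players) when Dominator makes the first move and both players play optimally. -}

module Defs where

open import Data.Fin using (Fin; zero; suc; inject₁; fromℕ)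
open import Data.Fin.Properties using (any?)
open import Data.Fin.Subset using (Subset; _∈_; _∉_; _∪_; ⁅_⁆) renaming (⊥ to ∅)
open import Data.Fin.Subset.Properties using (_∈?_)
open import Data.List using (List; []; _∷_; map; filter; allFin)
open import Data.List.Extrema.Nat using (min; max)
open import Data.Nat using (ℕ; zero; suc; NonZero)
open import Data.Product using (∃; _×_)
open import Data.Vec using (tabulate)
open import Function.Definitions using (Injective)
open import Level using (0ℓ)
open import Relation.Binary using (Rel; Decidable; Symmetric; Irreflexive)
open import Relation.Binary.Construct.Closure.ReflexiveTransitive using (Star)
open import Relation.Binary.PropositionalEquality using (_≡_)
open import Relation.Nullary using (¬_; Dec; does; ¬?; _×-dec_)

record Graph (n : ℕ) : Set₁ where
  infix 4 _~_ _~?_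
  field
    nonEmpty : NonZero n
    _~_      : Rel (Fin n) 0ℓ
    _~?_     : Decidable _~_
    ~-sym    : Symmetric _~_
    ~-irrefl : Irreflexive _≡_ _~_

module _ {n : ℕ} (G : Graph n) where
  open Graph G

  Connected : Set
  Connected = ∀ u v → Star _~_ u v

  -- The length is 3 + k, so that an edge walked back and forth is not a cycle.
  record Cycle : Set where
    field
      k        : ℕ
      vertex   : Fin (suc (suc (suc k))) → Fin n
      distinct : Injective _≡_ _≡_ vertex
      step     : ∀ i → vertex (inject₁ i) ~ vertex (suc i)
      close    : vertex (fromℕ (suc (suc k))) ~ vertex zero

  IsTree : Set
  IsTree = Connected × ¬ Cycle

-- Both graphs live on Fin n, so only the edges need to be compared.
IsSpanningTreeOf : ∀ {n} → Graph n → Graph n → Set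
IsSpanningTreeOf T G = (∀ {u v} → Graph._~_ T u v → Graph._~_ G u v) × IsTree T

data Player : Set where
  dominator staller : Player

opponent : Player → Player
opponent dominator = staller
opponent staller   = dominator

-- The number of moves still to be made, for the player to move, given the
-- values of the positions reachable by a legal move; the game is over when
-- there is none.
optimal : Player → List ℕ → ℕ
optimal _         []       = 0
optimal dominator (x ∷ xs) = suc (min x xs)
optimal staller   (x ∷ xs) = suc (max x xs)

module _ {n : ℕ} (G : Graph n) where
  open Graph G

  N[_] : Fin n → Subset n
  N[ v ] = ⁅ v ⁆ ∪ tabulate (λ u → does (v ~? u))

  -- A position is the set D of vertices dominated so far.
  Legal : Subset n → Fin n → Set
  Legal D v = ∃ λ u → u ∈ N[ v ] × u ∉ D

  legal? : ∀ D v → Dec (Legal D v)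
  legal? D v = any? λ u → (u ∈? N[ v ]) ×-dec ¬? (u ∈? D)

  -- An undominated vertex is itself a legal move, so legalMoves D is empty
  -- exactly when every vertex is dominated.
  legalMoves : Subset n → List (Fin n)
  legalMoves D = filter (legal? D) (allFin n)

  -- The minimax number of moves from position D with the given player to
  -- move.  The first argument bounds the recursion depth; the bound is
  -- immaterial once it is at least the number of undominated vertices, since
  -- every legal move dominates a new vertex.
  movesFrom : ℕ → Player → Subset n → ℕ
  movesFrom zero    p D = 0
  movesFrom (suc k) p D =
    optimal p (map (λ v → movesFrom k (opponent p) (D ∪ N[ v ])) (legalMoves D))

  γg : ℕ
  γg = movesFrom n dominator ∅

{-# OPTIONS --safe #-}
module Submission where

-- The vertices of G are a hub and, for each of K groups j, a port, three
-- roots, three leaves and three spares.  The tree T joins the hub to all ports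
-- and spares, each port to the roots of its group, and each root to its leaf;
-- G has in addition the edges from each spare to its root.
--
-- On T, Dominator starts with the hub.  From then on no spare is playable, and
-- every move either dominates a new leaf or is the only move on some port, so
-- the game lasts at most 1 + K + 3K moves.
--
-- On G, Staller plays spares, each of which dominates only one new root. With
-- A undominated roots and B undominated leaves, 2B + A drops by at most 3 in a
-- move of Dominator but by only 1 in a move of Staller while A > 0, and by at
-- most 2 per move when A = 0.  So the game lasts about 9K / 2 moves.

open import Data.Bool using (true)
open import Data.Fin using (Fin; zero; suc; inject₁; fromℕ; toℕ)
open import Data.Fin.Properties as Fin
  using (any?; all?; ¬∀⟶∃¬; toℕ-inject₁; +↔⊎; *↔×)
open import Data.Fin.Relation.Unary.Top using (view; ‵fromℕ; ‵inject₁)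
open import Data.Fin.Subset using (Subset; _∈_; _∉_; _∪_; ⁅_⁆; ∣_∣)
  renaming (⊥ to ∅)
open import Data.Fin.Subset.Properties
  using (_∈?_; ∉⊥; ∈⊤; ∣p∣≤n; ∣p∣≡n⇒p≡⊤; p⊂q⇒∣p∣<∣q∣; x∈p∪q⁻; x∈p∪q⁺; p⊆p∪q; x∈⁅x⁆; x∈⁅y⁆⇒x≡y)
open import Data.Integer using (+_; _-_; +≤+) renaming (_≥_ to _≥ℤ_)
import Data.Integer.Properties as ℤ
open import Data.List using ([]; _∷_; map; allFin)
open import Data.List.Extrema.Nat
  using (argmax; argmin-all; min≤⊤; min≤xs; max<v⁺; ⊥≤max; xs≤max; f[xs]≤f[argmax])
import Data.List.Membership.Propositional as List
open import Data.List.Membership.Propositional.Properties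
  using (∈-map⁺; ∈-filter⁺; ∈-allFin)
open import Data.List.Relation.Unary.All as All using (All; []; _∷_)
import Data.List.Relation.Unary.All.Properties as All
open import Data.List.Relation.Unary.Any using (here; there)
open import Data.Maybe using (Maybe; just; nothing)
import Data.Maybe.Properties as Maybe
open import Data.Nat
  using (ℕ; zero; suc; _+_; _*_; _≤_; _<_; _≥_; z≤n; s≤s; ⌊_/2⌋; ⌈_/2⌉; NonZero)
open import Data.Nat.Properties
open import Data.Nat.Tactic.RingSolver using (solve-∀)
open import Algebra.Properties.Monoid.Sum +-0-monoid using (sum)
open import Data.Product using (∃; _×_; _,_; proj₁; proj₂)
open import Data.Product.Function.NonDependent.Propositional using (_×-↔_)
open import Data.Sum using (_⊎_; inj₁; inj₂; [_,_]; swap)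
open import Data.Sum.Function.Propositional using (_⊎-↔_)
open import Data.Vec.Properties using (lookup⇒[]=; []=⇒lookup; lookup∘tabulate)
open import Function using (_∘_; id; _↔_; mk↔ₛ′; Inverse; Injection)
open import Function.Construct.Composition using (_↔-∘_)
open import Function.Construct.Identity using (↔-id)
open import Function.Properties.Inverse using (↔⇒↣; ↔-sym)
open import Level using (0ℓ)
open import Relation.Binary using (Rel; Decidable; DecidableEquality)
open import Relation.Binary.Construct.Closure.ReflexiveTransitive
  using (Star; ε; _◅_; _◅◅_; gmap; reverse)
open import Relation.Binary.PropositionalEquality
  using (_≡_; _≢_; refl; sym; trans; cong; cong₂; subst; subst₂; module ≡-Reasoning)
open import Relation.Nullary using (¬_; Dec; yes; no; does; ¬?; _⊎-dec_; contradiction)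
open import Relation.Nullary.Decidable using (via-injection; dec-true; decidable-stable)
open import Defs

-- Finite sums and indicators

sum-mono-≤ : ∀ {n} {f g : Fin n → ℕ} → (∀ i → f i ≤ g i) → sum f ≤ sum g
sum-mono-≤ {zero}  f≤g = z≤n
sum-mono-≤ {suc n} f≤g = +-mono-≤ (f≤g zero) (sum-mono-≤ (f≤g ∘ suc))

-- For a move that changes a count at one index while the other summands compare termwise. The pair
-- `c`, `d` is `1`, `0` for a strict decrease, and `0`, `1` or `0`, `3` for a limit on the drop.
sum-mono-≤-except : ∀ {n} {f g : Fin n → ℕ} c d i₀ →
  (∀ i → i ≢ i₀ → f i ≤ g i) → c + f i₀ ≤ d + g i₀ → c + sum f ≤ d + sum g
sum-mono-≤-except {suc n} {f} {g} c d zero f≤g c+f≤d+g = begin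
  c + (f zero + sum (f ∘ suc)) ≡⟨ +-assoc c _ _ ⟨
  c + f zero + sum (f ∘ suc)   ≤⟨ +-mono-≤ c+f≤d+g (sum-mono-≤ λ i → f≤g (suc i) λ ()) ⟩
  d + g zero + sum (g ∘ suc)   ≡⟨ +-assoc d _ _ ⟩
  d + (g zero + sum (g ∘ suc)) ∎
  where open ≤-Reasoning
sum-mono-≤-except {suc n} {f} {g} c d (suc i₀) f≤g c+f≤d+g = begin
  c + (f zero + sum (f ∘ suc)) ≡⟨ exchange c (f zero) _ ⟩
  f zero + (c + sum (f ∘ suc)) ≤⟨ +-mono-≤ (f≤g zero λ ())
                                    (sum-mono-≤-except c d i₀
                                      (λ i i≢i₀ → f≤g (suc i) (i≢i₀ ∘ Fin.suc-injective)) c+f≤d+g) ⟩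
  g zero + (d + sum (g ∘ suc)) ≡⟨ exchange d (g zero) _ ⟨
  d + (g zero + sum (g ∘ suc)) ∎
  where
  open ≤-Reasoning
  exchange : ∀ a b c → a + (b + c) ≡ b + (a + c)
  exchange = solve-∀

sum-≤ : ∀ {n c} {f : Fin n → ℕ} → (∀ i → f i ≤ c) → sum f ≤ n * c
sum-≤ {zero}  f≤c = z≤n
sum-≤ {suc n} f≤c = +-mono-≤ (f≤c zero) (sum-≤ (f≤c ∘ suc))

sum-≥ : ∀ {n c} {f : Fin n → ℕ} → (∀ i → c ≤ f i) → n * c ≤ sum f
sum-≥ {zero}  c≤f = z≤n
sum-≥ {suc n} c≤f = +-mono-≤ (c≤f zero) (sum-≥ (c≤f ∘ suc))

private variable
  P Q : Set

indicator : Dec P → ℕ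
indicator (yes _) = 1
indicator (no _)  = 0

indicator-≤1 : (p? : Dec P) → indicator p? ≤ 1
indicator-≤1 (yes _) = ≤-refl
indicator-≤1 (no _)  = z≤n

indicator-mono : (p? : Dec P) (q? : Dec Q) → (P → Q) → indicator p? ≤ indicator q?
indicator-mono (yes p) (yes _) _   = ≤-refl
indicator-mono (yes p) (no ¬q) p⇒q = contradiction (p⇒q p) ¬q
indicator-mono (no _)  _       _   = z≤n

indicator-< : (p? : Dec P) (q? : Dec Q) → ¬ P → Q → indicator p? < indicator q?
indicator-< (yes p) _       ¬p _ = contradiction p ¬p
indicator-< (no _)  (yes _) _  _ = ≤-refl
indicator-< (no _)  (no ¬q) _  q = contradiction q ¬q

indicator-yes : (p? : Dec P) → P → 1 ≤ indicator p?
indicator-yes (yes _) _ = ≤-refl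
indicator-yes (no ¬p) p = contradiction p ¬p

does⇒ : (p? : Dec P) → does p? ≡ true → P
does⇒ (yes p) _ = p

+≤⇒≤- : ∀ {i m n} → i + n ≤ m → (+ m - + n) ≥ℤ (+ i)
+≤⇒≤- {i} {m} {n} i+n≤m = subst (_≥ℤ (+ i))
  (sym (trans (ℤ.m-n≡m⊖n m n) (ℤ.⊖-≥ (m+n≤o⇒n≤o i i+n≤m))))
  (+≤+ (m+n≤o⇒m≤o∸n i i+n≤m))

-- Minimax bounds for the domination game

optimal-≤ : ∀ p {xs c} → All (_< c) xs → optimal p xs ≤ c
optimal-≤ dominator []                    = z≤n
optimal-≤ staller   []                    = z≤n
optimal-≤ dominator {x ∷ xs} (x<c ∷ _)    = ≤-trans (s≤s (min≤⊤ x xs)) x<c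
optimal-≤ staller   {x ∷ xs} (x<c ∷ xs<c) = max<v⁺ x<c xs<c

optimal-dominator-≤ : ∀ {x xs} → x List.∈ xs → optimal dominator xs ≤ suc x
optimal-dominator-≤ {xs = y ∷ ys} (here refl)  = s≤s (min≤⊤ y ys)
optimal-dominator-≤ {xs = y ∷ ys} (there x∈ys) = s≤s (All.lookup (min≤xs y ys) x∈ys)

-- The member `x` rules out the empty list, on which `optimal` returns 0.
optimal-dominator-≥ : ∀ {x xs c} → x List.∈ xs → All (λ y → c ≤ suc y) xs →
                      c ≤ optimal dominator xs
optimal-dominator-≥ {c = c} _ (c≤ ∷ cs≤) = argmin-all id {P = λ y → c ≤ suc y} c≤ cs≤

optimal-staller-≥ : ∀ {x xs} → x List.∈ xs → suc x ≤ optimal staller xs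
optimal-staller-≥ {xs = y ∷ ys} (here refl)  = s≤s (⊥≤max y ys)
optimal-staller-≥ {xs = y ∷ ys} (there x∈ys) = s≤s (All.lookup (xs≤max y ys) x∈ys)

module _ {n : ℕ} (G : Graph n) where

  after : Subset n → Fin n → Subset n
  after D v = D ∪ N[_] G v

  value-∈ : ∀ k p {D v} → Legal G D v →
            movesFrom G k p (after D v) List.∈
              map (λ w → movesFrom G k p (after D w)) (legalMoves G D)
  value-∈ k p {D} {v} legal =
    ∈-map⁺ (λ w → movesFrom G k p (after D w)) (∈-filter⁺ (legal? G D) (∈-allFin v) legal)

  ∈N[self] : ∀ v → v ∈ N[_] G v
  ∈N[self] v = x∈p∪q⁺ (inj₁ (x∈⁅x⁆ v))

  ∣after∣-< : ∀ {D v} → Legal G D v → ∣ D ∣ < ∣ after D v ∣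
  ∣after∣-< {D} {v} (u , u∈N , u∉D) =
    p⊂q⇒∣p∣<∣q∣ (p⊆p∪q _ , u , x∈p∪q⁺ {p = D} (inj₂ u∈N) , u∉D)

  -- A potential argument: every legal move lowers `φ`, whoever plays it, so no strategy is
  -- involved. Any depth `k` will do, since running out of depth yields 0.
  movesFrom-≤ : (I : Subset n → Set) (φ : Subset n → ℕ) →
    (∀ {D v} → I D → Legal G D v → I (after D v) × φ (after D v) < φ D) →
    ∀ k p {D} → I D → movesFrom G k p D ≤ φ D
  movesFrom-≤ I φ step zero    p ID = z≤n
  movesFrom-≤ I φ step (suc k) p {D} ID =
    optimal-≤ p (All.map⁺ (All.map below (All.all-filter (legal? G D) (allFin n))))
    where
    below : ∀ {v} → Legal G D v → movesFrom G k (opponent p) (after D v) < φ D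
    below legal with step ID legal
    ... | ID′ , φ< = ≤-<-trans (movesFrom-≤ I φ step k (opponent p) ID′) φ<

  -- Staller needs a strategy here: the condition on Dominator covers all legal moves, the one on
  -- Staller asks for a single good move. `φ` sees whose turn it is, so that unequal losses can
  -- balance over two moves. The inequality `n ≤ k + ∣ D ∣` guarantees enough depth to finish the
  -- game.
  movesFrom-≥ : (φ : Player → Subset n → ℕ) →
    (∀ p {D} → (∀ v → v ∈ D) → φ p D ≡ 0) →
    (∀ {D v} → Legal G D v → φ dominator D ≤ suc (φ staller (after D v))) →
    (∀ D → φ staller D ≡ 0 ⊎
           ∃ λ v → Legal G D v × φ staller D ≤ suc (φ dominator (after D v))) →
    ∀ k p D → n ≤ k + ∣ D ∣ → φ p D ≤ movesFrom G k p D
  movesFrom-≥ φ final dominatorStep stallerStep = bound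
    where
    bound : ∀ k p D → n ≤ k + ∣ D ∣ → φ p D ≤ movesFrom G k p D
    -- At depth 0 the inequality forces `D` to be everything, so `φ` vanishes as well.
    bound zero p D n≤∣D∣ = ≤-reflexive (final p λ v → subst (v ∈_) (sym D≡⊤) ∈⊤)
      where D≡⊤ = ∣p∣≡n⇒p≡⊤ (≤-antisym (∣p∣≤n D) n≤∣D∣)
    bound (suc k) p D n≤ with all? (_∈? D)
    ... | yes full = ≤-trans (≤-reflexive (final p full)) z≤n
    ... | no ¬full = go p
      where
      fuel : ∀ {v} → Legal G D v → n ≤ k + ∣ after D v ∣
      fuel legal = ≤-trans n≤ (≤-trans (≤-reflexive (sym (+-suc k ∣ D ∣)))
                                       (+-monoʳ-≤ k (∣after∣-< legal)))

      go : ∀ p → φ p D ≤ movesFrom G (suc k) p D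
      go dominator with ¬∀⟶∃¬ n _ (_∈? D) ¬full
      ... | u , u∉D = optimal-dominator-≥
        (value-∈ k staller {D} (u , ∈N[self] u , u∉D))
        (All.map⁺ (All.map
          (λ {v} legal → ≤-trans (dominatorStep legal) (s≤s (bound k staller (after D v) (fuel legal))))
          (All.all-filter (legal? G D) (allFin n))))
      go staller with stallerStep D
      ... | inj₁ ≡0 = ≤-trans (≤-reflexive ≡0) z≤n
      ... | inj₂ (v , legal , φ≤) = ≤-trans φ≤
        (≤-trans (s≤s (bound k dominator (after D v) (fuel legal)))
                 (optimal-staller-≥ (value-∈ k dominator legal)))

  -- Any fixed opening `v` bounds Dominator's minimum. Writing `n` as `suc m` lets that first move
  -- unfold.
  γg-≤ : ∀ {m k} → n ≡ suc m → ∀ v →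
         (∀ i → movesFrom G i staller (after ∅ v) ≤ k) → γg G ≤ suc k
  γg-≤ {m} refl v bound = ≤-trans
    (optimal-dominator-≤ (value-∈ m staller {∅} (v , ∈N[self] v , ∉⊥)))
    (s≤s (bound m))

-- Cycles

module _ {n : ℕ} (G : Graph n) where
  open Graph G

  cycle-neighbours : (C : Cycle G) → let open Cycle C in
    ∀ i → ∃ λ p → ∃ λ q → p ≢ q × vertex i ~ vertex p × vertex i ~ vertex q
  cycle-neighbours C zero =
    fromℕ (suc (suc k)) , suc zero , (λ ()) , ~-sym close , step zero
    where open Cycle C
  cycle-neighbours C (suc i) with view i
  ... | ‵fromℕ =
    zero , inject₁ (fromℕ (suc k)) , (λ ()) , close , ~-sym (step (fromℕ (suc k)))
    where open Cycle C
  ... | ‵inject₁ j =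
    inject₁ (inject₁ j) , suc (suc j) , p≢q , ~-sym (step (inject₁ j)) , step (suc j)
    where
    open Cycle C
    p≢q : inject₁ (inject₁ j) ≢ suc (suc j)
    -- The two indices lie on either side of `1 + toℕ j`, so they differ by 2.
    p≢q p≡q = m≢1+n+m (toℕ j) {1} (trans (sym (trans (toℕ-inject₁ (inject₁ j)) (toℕ-inject₁ j)))
                                          (cong toℕ p≡q))

  -- A deepest vertex of a cycle would have two such neighbours.
  acyclic : (depth : Fin n → ℕ) →
    (∀ {u v w} → v ~ u → v ~ w → depth u ≤ depth v → depth w ≤ depth v → u ≡ w) →
    ¬ Cycle G
  acyclic depth unique C = clash (cycle-neighbours C deepest)
    where
    open Cycle C
    deepest = argmax (depth ∘ vertex) zero (allFin (suc (suc (suc k))))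

    ≤-deepest : ∀ i → depth (vertex i) ≤ depth (vertex deepest)
    ≤-deepest i =
      All.lookup (f[xs]≤f[argmax] {f = depth ∘ vertex} zero (allFin (suc (suc (suc k))))) (∈-allFin i)

    clash : ¬ ∃ λ p → ∃ λ q → p ≢ q × vertex deepest ~ vertex p × vertex deepest ~ vertex q
    clash (p , q , p≢q , v~p , v~q) =
      p≢q (distinct (unique v~p v~q (≤-deepest p) (≤-deepest q)))

-- Graphs from arcs on an enumerated vertex type

module Undirected {n} (n≢0 : NonZero n) {V : Set} (enumeration : Fin n ↔ V)
  (_⟶_ : Rel V 0ℓ) (_⟶?_ : Decidable _⟶_) (⟶-irrefl : ∀ v → ¬ v ⟶ v) where

  open Inverse enumeration renaming (to to decode; from to encode)

  Adjacent : Rel V 0ℓ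
  Adjacent v w = v ⟶ w ⊎ w ⟶ v

  Near : Rel V 0ℓ
  Near v w = w ≡ v ⊎ Adjacent v w

  graph : Graph n
  graph = record
    { nonEmpty = n≢0
    ; _~_      = λ i j → Adjacent (decode i) (decode j)
    ; _~?_     = λ i j → (decode i ⟶? decode j) ⊎-dec (decode j ⟶? decode i)
    ; ~-sym    = swap
    ; ~-irrefl = λ { refl → [ ⟶-irrefl _ , ⟶-irrefl _ ] }
    }
  open Graph graph

  ∈N⇒Near : ∀ {v w} → encode w ∈ N[_] graph v → Near (decode v) w
  ∈N⇒Near {v} {w} w∈N with x∈p∪q⁻ ⁅ v ⁆ _ w∈N
  ... | inj₁ w∈⁅v⁆ = inj₁ (trans (sym (strictlyInverseˡ w)) (cong decode (x∈⁅y⁆⇒x≡y v w∈⁅v⁆)))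
  ... | inj₂ w∈tab = inj₂ (subst (Adjacent (decode v)) (strictlyInverseˡ w)
    (does⇒ (v ~? encode w) (trans (sym (lookup∘tabulate (λ u → does (v ~? u)) (encode w)))
                                  ([]=⇒lookup w∈tab))))

  Near⇒∈N : ∀ {v w} → Near (decode v) w → encode w ∈ N[_] graph v
  Near⇒∈N {v} (inj₁ refl) = subst (_∈ N[_] graph v) (sym (strictlyInverseʳ v)) (∈N[self] graph v)
  Near⇒∈N {v} {w} (inj₂ v~w) = x∈p∪q⁺ {p = ⁅ v ⁆} (inj₂ (lookup⇒[]= (encode w) _
    (trans (lookup∘tabulate (λ u → does (v ~? u)) (encode w))
           (dec-true (v ~? encode w) (subst (Adjacent (decode v)) (sym (strictlyInverseˡ w)) v~w)))))

  -- States that `D′` is `D` together with the closed neighborhood of `v`, as three implications on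
  -- `V`. The analysis of the games can then match on vertices without touching subsets or codes.
  record Move (D D′ : Subset n) (v : V) : Set where
    field
      keeps     : ∀ {w} → encode w ∈ D → encode w ∈ D′
      dominates : ∀ {w} → Near v w → encode w ∈ D′
      only      : ∀ {w} → encode w ∈ D′ → encode w ∈ D ⊎ Near v w

  -- The equation serves two situations: `refl` for an arbitrary move `v`, and the inverse law when
  -- the move is `encode c` for a chosen vertex `c`.
  move : ∀ {D v c} → decode v ≡ c → Move D (after graph D v) c
  move {D} refl = record
    { keeps     = λ w∈D → x∈p∪q⁺ {p = D} (inj₁ w∈D)
    ; dominates = λ near → x∈p∪q⁺ {p = D} (inj₂ (Near⇒∈N near))
    ; only      = λ w∈ → [ inj₁ , inj₂ ∘ ∈N⇒Near ] (x∈p∪q⁻ D _ w∈)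
    }

  legal⇒near : ∀ {D v} → Legal graph D v → ∃ λ w → Near (decode v) w × encode w ∉ D
  legal⇒near {D} {v} (u , u∈N , u∉D) =
    decode u , ∈N⇒Near (subst (_∈ N[_] graph v) (sym (strictlyInverseʳ u)) u∈N) ,
    u∉D ∘ subst (_∈ D) (strictlyInverseʳ u)

  near⇒legal : ∀ {D v w} → Near v w → encode w ∉ D → Legal graph D (encode v)
  near⇒legal {v = v} {w} near w∉D =
    encode w , Near⇒∈N (subst (λ c → Near c w) (sym (strictlyInverseˡ v)) near) , w∉D

  connected : ∀ r → (∀ v → Star Adjacent v r) → Connected graph
  connected r path u v = toRoot u ◅◅ reverse swap (toRoot v)
    where
    lift : ∀ {a b} → Adjacent a b → Adjacent (decode (encode a)) (decode (encode b))
    lift = subst₂ Adjacent (sym (strictlyInverseˡ _)) (sym (strictlyInverseˡ _))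
    toRoot : ∀ u → Star _~_ u (encode r)
    toRoot u = subst (λ u → Star _~_ u (encode r)) (strictlyInverseʳ u)
                 (gmap encode lift (path (decode u)))

-- The vertex set and its enumeration

data Vertex (K : ℕ) : Set where
  hub             : Vertex K
  port            : Fin K → Vertex K
  root leaf spare : Fin K → Fin 3 → Vertex K

-- The size is read as one hub and `K` groups, each with one port and a block `Fin 3 × Fin 3`. The
-- first coordinate of the block is the slot, the second selects root, leaf or spare.
vertices : ∀ K → Fin (1 + K * (1 + 3 * 3)) ↔ Vertex K
vertices K = mk↔ₛ′ build split build∘split split∘build ↔-∘
  ((↔-id _ ⊎-↔ ((↔-id _ ×-↔ ((↔-id _ ⊎-↔ *↔×) ↔-∘ +↔⊎)) ↔-∘ *↔×)) ↔-∘ +↔⊎)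
  where
  Code : Set
  Code = Fin 1 ⊎ Fin K × (Fin 1 ⊎ Fin 3 × Fin 3)

  build : Code → Vertex K
  build (inj₁ zero)                             = hub
  build (inj₂ (j , inj₁ zero))                  = port j
  build (inj₂ (j , inj₂ (i , zero)))            = root j i
  build (inj₂ (j , inj₂ (i , suc zero)))        = leaf j i
  build (inj₂ (j , inj₂ (i , suc (suc zero))))  = spare j i

  split : Vertex K → Code
  split hub         = inj₁ zero
  split (port j)    = inj₂ (j , inj₁ zero)
  split (root j i)  = inj₂ (j , inj₂ (i , zero))
  split (leaf j i)  = inj₂ (j , inj₂ (i , suc zero))
  split (spare j i) = inj₂ (j , inj₂ (i , suc (suc zero)))

  build∘split : ∀ v → build (split v) ≡ v
  build∘split hub         = refl
  build∘split (port j)    = refl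
  build∘split (root j i)  = refl
  build∘split (leaf j i)  = refl
  build∘split (spare j i) = refl

  split∘build : ∀ c → split (build c) ≡ c
  split∘build (inj₁ zero)                            = refl
  split∘build (inj₂ (j , inj₁ zero))                 = refl
  split∘build (inj₂ (j , inj₂ (i , zero)))           = refl
  split∘build (inj₂ (j , inj₂ (i , suc zero)))       = refl
  split∘build (inj₂ (j , inj₂ (i , suc (suc zero)))) = refl

-- The tree and the graph containing it

module Construction (K : ℕ) {m} (enumeration : Fin (suc m) ↔ Vertex K) where

  open Inverse enumeration using (strictlyInverseˡ; strictlyInverseʳ) renaming (to to decode; from to encode)

  _≟ᵥ_ : DecidableEquality (Vertex K)
  _≟ᵥ_ = via-injection (↔⇒↣ (↔-sym enumeration)) Fin._≟_

  parent : Vertex K → Maybe (Vertex K)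
  parent hub         = nothing
  parent (port j)    = just hub
  parent (root j i)  = just (port j)
  parent (leaf j i)  = just (root j i)
  parent (spare j i) = just hub

  chord : Vertex K → Maybe (Vertex K)
  chord hub         = nothing
  chord (port j)    = nothing
  chord (root j i)  = nothing
  chord (leaf j i)  = nothing
  chord (spare j i) = just (root j i)

  depth : Vertex K → ℕ
  depth hub         = 0
  depth (port j)    = 1
  depth (root j i)  = 2
  depth (leaf j i)  = 3
  depth (spare j i) = 1

  parent-depth : ∀ v {w} → parent v ≡ just w → depth w < depth v
  parent-depth (port j)    refl = ≤-refl
  parent-depth (root j i)  refl = ≤-refl
  parent-depth (leaf j i)  refl = ≤-refl
  parent-depth (spare j i) refl = ≤-refl

  chord-irrefl : ∀ v → ¬ chord v ≡ just v
  chord-irrefl (spare j i) ()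

  maybe-≟ : DecidableEquality (Maybe (Vertex K))
  maybe-≟ = Maybe.≡-dec _≟ᵥ_

  module T = Undirected _ enumeration
    (λ v w → parent v ≡ just w)
    (λ v w → maybe-≟ (parent v) (just w))
    (λ v p → <-irrefl refl (parent-depth v p))

  module G = Undirected _ enumeration
    (λ v w → parent v ≡ just w ⊎ chord v ≡ just w)
    (λ v w → maybe-≟ (parent v) (just w) ⊎-dec maybe-≟ (chord v) (just w))
    (λ v → [ <-irrefl refl ∘ parent-depth v , chord-irrefl v ])

  T⊆G : ∀ {u v} → Graph._~_ T.graph u v → Graph._~_ G.graph u v
  T⊆G (inj₁ p) = inj₁ (inj₁ p)
  T⊆G (inj₂ p) = inj₂ (inj₁ p)

  path-to-hub : ∀ v → Star T.Adjacent v hub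
  path-to-hub hub         = ε
  path-to-hub (port j)    = inj₁ refl ◅ ε
  path-to-hub (root j i)  = inj₁ refl ◅ inj₁ refl ◅ ε
  path-to-hub (leaf j i)  = inj₁ refl ◅ inj₁ refl ◅ inj₁ refl ◅ ε
  path-to-hub (spare j i) = inj₁ refl ◅ ε

  -- An arc to a parent lowers the depth, so an edge that does not go deeper can only lead to the
  -- parent. As parents are unique, this is what `acyclic` asks for.
  upward : ∀ {v u} → T.Adjacent v u → depth u ≤ depth v → parent v ≡ just u
  upward         (inj₁ p) _   = p
  upward {v} {u} (inj₂ p) u≤v = contradiction (parent-depth u p) (≤⇒≯ u≤v)

  T-acyclic : ¬ Cycle T.graph
  T-acyclic = acyclic T.graph (depth ∘ decode) λ v~u v~w u≤v w≤v →
    Injection.injective (↔⇒↣ enumeration)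
      (Maybe.just-injective (trans (sym (upward v~u u≤v)) (upward v~w w≤v)))

  T-spanning : IsSpanningTreeOf T.graph G.graph
  T-spanning = T⊆G , T.connected hub path-to-hub , T-acyclic

  -- Counting undominated vertices

  private variable
    D D′ : Subset (suc m)

  undominated? : ∀ D v → Dec (encode v ∉ D)
  undominated? D v = ¬? (encode v ∈? D)

  missing : (Fin K → Fin 3 → Vertex K) → Subset (suc m) → ℕ
  missing f D = sum λ j → sum λ i → indicator (undominated? D (f j i))

  module _ (f : Fin K → Fin 3 → Vertex K) where

    private
      pointwise : ∀ j i → (encode (f j i) ∈ D′ → encode (f j i) ∈ D) →
                  indicator (undominated? D (f j i)) ≤ indicator (undominated? D′ (f j i))
      pointwise {D′} {D} j i old =
        indicator-mono (undominated? D (f j i)) (undominated? D′ (f j i)) (_∘ old)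

    missing-mono : (∀ j i → encode (f j i) ∈ D′ → encode (f j i) ∈ D) →
                   missing f D ≤ missing f D′
    missing-mono old = sum-mono-≤ λ j → sum-mono-≤ λ i → pointwise j i (old j i)

    missing-drop₁ : ∀ j₀ i₀ →
      (∀ j i → (j , i) ≢ (j₀ , i₀) → encode (f j i) ∈ D′ → encode (f j i) ∈ D) →
      missing f D ≤ 1 + missing f D′
    missing-drop₁ j₀ i₀ old = sum-mono-≤-except 0 1 j₀
      (λ j j≢j₀ → sum-mono-≤ λ i → pointwise j i (old j i (j≢j₀ ∘ cong proj₁)))
      (sum-mono-≤-except 0 1 i₀
        (λ i i≢i₀ → pointwise j₀ i (old j₀ i (i≢i₀ ∘ cong proj₂)))
        (≤-trans (indicator-≤1 (undominated? _ (f j₀ i₀))) (m≤m+n 1 _)))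

    -- A group contributes three indicators, so its inner sum is at most 3 before the move.
    missing-drop₃ : ∀ j₀ →
      (∀ j i → j ≢ j₀ → encode (f j i) ∈ D′ → encode (f j i) ∈ D) →
      missing f D ≤ 3 + missing f D′
    missing-drop₃ {D = D} j₀ old = sum-mono-≤-except 0 3 j₀
      (λ j j≢j₀ → sum-mono-≤ λ i → pointwise j i (old j i j≢j₀))
      (≤-trans (sum-≤ λ i → indicator-≤1 (undominated? D (f j₀ i))) (m≤m+n 3 _))

    missing-strict : (∀ j i → encode (f j i) ∈ D → encode (f j i) ∈ D′) →
      ∀ j₀ i₀ → encode (f j₀ i₀) ∉ D → encode (f j₀ i₀) ∈ D′ →
      missing f D′ < missing f D
    missing-strict kept j₀ i₀ ∉D ∈D′ = sum-mono-≤-except 1 0 j₀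
      (λ j _ → sum-mono-≤ λ i → pointwise j i (kept j i))
      (sum-mono-≤-except 1 0 i₀
        (λ i _ → pointwise j₀ i (kept j₀ i))
        (indicator-< (undominated? _ (f j₀ i₀)) (undominated? _ (f j₀ i₀)) (λ ∉D′ → ∉D′ ∈D′) ∉D))

    missing-≤ : missing f D ≤ K * 3
    missing-≤ {D} = sum-≤ λ j → sum-≤ λ i → indicator-≤1 (undominated? D (f j i))

    missing-∅ : K * 3 ≤ missing f ∅
    missing-∅ = sum-≥ λ j → sum-≥ λ i → indicator-yes (undominated? _ (f j i)) ∉⊥

    missing≡0 : (∀ j i → encode (f j i) ∈ D) → missing f D ≡ 0
    missing≡0 dominated = n≤0⇒n≡0 (≤-trans
      (sum-≤ {c = 0} λ j → sum-≤ {c = 0} λ i →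
        -- `no id` decides the empty type, and its indicator computes to the bound 0.
        indicator-mono (undominated? _ (f j i)) (no id) (λ ∉D → ∉D (dominated j i)))
      (≤-reflexive (*-zeroʳ K)))

    some-missing? : ∀ D → (∃ λ j → ∃ λ i → encode (f j i) ∉ D) ⊎ missing f D ≡ 0
    some-missing? D with any? (λ j → any? λ i → undominated? D (f j i))
    ... | yes some = inj₁ some
    ... | no ¬some = inj₂ (missing≡0 λ j i →
      decidable-stable (encode (f j i) ∈? D) λ ∉D → ¬some (j , i , ∉D))

  -- The game on T

  -- Once the hub has been played in the tree, a port can newly dominate only roots of its group, so
  -- this decides whether the port is still playable.
  port-useful? : ∀ D j → Dec (∃ λ i → encode (root j i) ∉ D)
  port-useful? D j = any? λ i → undominated? D (root j i)

  usefulPorts : Subset (suc m) → ℕ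
  usefulPorts D = sum λ j → indicator (port-useful? D j)

  potential : Subset (suc m) → ℕ
  potential D = usefulPorts D + missing leaf D

  -- The invariant of the game after Dominator's opening. Through the contrapositive of `leaf⇒root`,
  -- a new root dominated by a root or leaf move comes with a new leaf.
  record HubPlayed (D : Subset (suc m)) : Set where
    field
      hub∈      : encode hub ∈ D
      port∈     : ∀ j → encode (port j) ∈ D
      spare∈    : ∀ j i → encode (spare j i) ∈ D
      leaf⇒root : ∀ j i → encode (leaf j i) ∈ D → encode (root j i) ∈ D

  parent≢leaf : ∀ v {j i} → parent v ≢ just (leaf j i)
  parent≢leaf (port _) ()

  -- In the tree only the leaf itself and its root dominate a leaf, and both also dominate the root.
  near-leaf⇒near-root : ∀ v {j i} → T.Near v (leaf j i) → T.Near v (root j i)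
  near-leaf⇒near-root _           (inj₁ refl)        = inj₂ (inj₁ refl)
  near-leaf⇒near-root (root j i)  (inj₂ (inj₂ refl)) = inj₁ refl
  near-leaf⇒near-root v           (inj₂ (inj₁ p))    = contradiction p (parent≢leaf v)

  hubPlayed-preserved : ∀ {v} → HubPlayed D → T.Move D D′ v → HubPlayed D′
  hubPlayed-preserved {v = v} played m = record
    { hub∈      = keeps hub∈
    ; port∈     = λ j → keeps (port∈ j)
    ; spare∈    = λ j i → keeps (spare∈ j i)
    ; leaf⇒root = λ j i leaf∈ →
        [ keeps ∘ leaf⇒root j i , dominates ∘ near-leaf⇒near-root v ] (only leaf∈)
    }
    where
    open HubPlayed played
    open T.Move m

  usefulPorts-mono : ∀ {v} → T.Move D D′ v → usefulPorts D′ ≤ usefulPorts D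
  usefulPorts-mono m = sum-mono-≤ λ j →
    indicator-mono (port-useful? _ j) (port-useful? _ j) λ (i , ∉D′) → i , ∉D′ ∘ T.Move.keeps m

  leaf-move : ∀ {v j i} → T.Near v (leaf j i) → T.Move D D′ v →
              encode (leaf j i) ∉ D → potential D′ < potential D
  leaf-move {j = j} {i} near m ∉D = +-mono-≤-< (usefulPorts-mono m)
    (missing-strict leaf (λ _ _ → keeps) j i ∉D (dominates near))
    where open T.Move m

  port-move : ∀ {j i} → T.Move D D′ (port j) → encode (root j i) ∉ D →
              potential D′ < potential D
  port-move {j = j} {i} m ∉D = +-mono-<-≤
    (sum-mono-≤-except 1 0 j
      (λ j′ _ → indicator-mono (port-useful? _ j′) (port-useful? _ j′) λ (i , ∉D′) → i , ∉D′ ∘ keeps)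
      (indicator-< (port-useful? _ j) (port-useful? _ j)
        (λ (i , ∉D′) → ∉D′ (dominates (inj₂ (inj₂ refl)))) (i , ∉D)))
    (missing-mono leaf (λ _ _ → keeps))
    where open T.Move m

  -- By the invariant the new vertex `w` is a leaf or a root. A root can be dominated by itself or
  -- its leaf, which reaches a new leaf, or by its port, which then stops being useful.
  potential-decreases : ∀ v w → HubPlayed D → T.Move D D′ v → T.Near v w → encode w ∉ D →
                        potential D′ < potential D
  potential-decreases _ hub         played m near w∉D = contradiction hub∈ w∉D
    where open HubPlayed played
  potential-decreases _ (port j)    played m near w∉D = contradiction (port∈ j) w∉D
    where open HubPlayed played
  potential-decreases _ (spare j i) played m near w∉D = contradiction (spare∈ j i) w∉D
    where open HubPlayed played
  potential-decreases _ (leaf j i)  played m near w∉D = leaf-move near m w∉D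
  -- The root itself is played. Its leaf is undominated too, by the contrapositive of `leaf⇒root`,
  -- and this move dominates it.
  potential-decreases _ (root j i)  played m (inj₁ refl) w∉D =
    leaf-move (inj₂ (inj₂ refl)) m (w∉D ∘ leaf⇒root j i)
    where open HubPlayed played
  potential-decreases _ (root j i)  played m (inj₂ (inj₂ refl)) w∉D = port-move m w∉D
  potential-decreases (leaf j i) (root _ _) played m (inj₂ (inj₁ refl)) w∉D =
    leaf-move (inj₁ refl) m (w∉D ∘ leaf⇒root j i)
    where open HubPlayed played

  hubPlayed-first : ∀ {D′} → T.Move ∅ D′ hub → HubPlayed D′
  hubPlayed-first m = record
    { hub∈      = dominates (inj₁ refl)
    ; port∈     = λ j → dominates (inj₂ (inj₂ refl))
    ; spare∈    = λ j i → dominates (inj₂ (inj₂ refl))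
    ; leaf⇒root = λ j i leaf∈ →
        [ (λ ∈∅ → contradiction ∈∅ ∉⊥) , dominates ∘ near-leaf⇒near-root hub ] (only leaf∈)
    }
    where open T.Move m

  γg-T-≤ : γg T.graph ≤ 1 + (K * 1 + K * 3)
  γg-T-≤ = γg-≤ T.graph refl (encode hub) λ k → ≤-trans
    (movesFrom-≤ T.graph HubPlayed potential
      (λ {D} {v} played legal → let w , near , w∉D = T.legal⇒near legal in
        hubPlayed-preserved played (T.move {D} {v} refl) ,
        potential-decreases (decode v) w played (T.move {D} {v} refl) near w∉D)
      k staller (hubPlayed-first (T.move {∅} (strictlyInverseˡ hub))))
    (+-mono-≤ (sum-≤ λ j → indicator-≤1 (port-useful? _ j)) (missing-≤ leaf))

  -- The game on G

  -- Half of `2B + A`, rounded according to the turn. The rounding absorbs the unequal losses: with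
  -- `a` roots left after the move, `⌊ 3 + a /2⌋` is `1 + ⌈ a /2⌉` for Dominator and `⌈ 1 + a /2⌉`
  -- is `1 + ⌊ a /2⌋` for Staller.
  lowerBound : Player → Subset (suc m) → ℕ
  lowerBound dominator D = missing leaf D + ⌊ missing root D /2⌋
  lowerBound staller   D = missing leaf D + ⌈ missing root D /2⌉

  chord≢leaf : ∀ v {j i} → chord v ≢ just (leaf j i)
  chord≢leaf (spare _ _) ()

  near-leaf : ∀ v {j i} → G.Near v (leaf j i) → v ≡ root j i ⊎ v ≡ leaf j i
  near-leaf _ (inj₁ refl)               = inj₂ refl
  near-leaf _ (inj₂ (inj₂ (inj₁ refl))) = inj₁ refl
  near-leaf v (inj₂ (inj₁ (inj₁ p)))  = contradiction p (parent≢leaf v)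
  near-leaf v (inj₂ (inj₁ (inj₂ p)))  = contradiction p (chord≢leaf v)

  data InSlot (j : Fin K) (i : Fin 3) : Vertex K → Set where
    is-root  : InSlot j i (root j i)
    is-leaf  : InSlot j i (leaf j i)
    is-spare : InSlot j i (spare j i)

  inSlot-unique : ∀ {v j i j′ i′} → InSlot j i v → InSlot j′ i′ v → (j , i) ≡ (j′ , i′)
  inSlot-unique is-root  is-root  = refl
  inSlot-unique is-leaf  is-leaf  = refl
  inSlot-unique is-spare is-spare = refl

  near-root : ∀ v {j i} → G.Near v (root j i) → v ≡ port j ⊎ InSlot j i v
  near-root _           (inj₁ refl)               = inj₂ is-root
  near-root _           (inj₂ (inj₂ (inj₁ refl))) = inj₁ refl
  near-root (leaf _ _)  (inj₂ (inj₁ (inj₁ refl))) = inj₂ is-leaf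
  near-root (spare _ _) (inj₂ (inj₁ (inj₂ refl))) = inj₂ is-spare

  near-leaf-inSlot : ∀ v {j i} → G.Near v (leaf j i) → InSlot j i v
  near-leaf-inSlot v near with near-leaf v near
  ... | inj₁ refl = is-root
  ... | inj₂ refl = is-leaf

  -- Among all roots and leaves, a vertex of a slot is near only those of its own slot.
  inSlot-step : ∀ {v j i} → InSlot j i v → G.Move D D′ v →
                missing root D ≤ 1 + missing root D′ × missing leaf D ≤ 1 + missing leaf D′
  inSlot-step {v = v} {j₀} {i₀} slot m =
    missing-drop₁ root j₀ i₀ (λ j i ≢ ∈D′ →
      [ id , (λ near → contradiction (root-slot near) ≢) ] (only ∈D′)) ,
    missing-drop₁ leaf j₀ i₀ (λ j i ≢ ∈D′ →
      [ id , (λ near → contradiction (inSlot-unique (near-leaf-inSlot v near) slot) ≢) ] (only ∈D′))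
    where
    open G.Move m
    root-slot : ∀ {j i} → G.Near v (root j i) → (j , i) ≡ (j₀ , i₀)
    root-slot near with near-root v near
    ... | inj₂ slot′ = inSlot-unique slot′ slot
    ... | inj₁ refl  = contradiction slot λ ()

  leaf-free-move : ∀ {v} → (∀ j i → ¬ InSlot j i v) → G.Move D D′ v →
                   missing leaf D ≤ missing leaf D′
  leaf-free-move {v = v} ¬slot m = missing-mono leaf λ j i ∈D′ →
    [ id , (λ near → contradiction (near-leaf-inSlot v near) (¬slot j i)) ] (G.Move.only m ∈D′)

  private
    inSlot-bound : ∀ {v j i} → InSlot j i v → G.Move D D′ v →
                   lowerBound dominator D ≤ suc (lowerBound staller D′)
    inSlot-bound slot m with inSlot-step slot m
    -- `⌊ suc a /2⌋` is `⌈ a /2⌉` by definition: the lost leaf pays for the move and the rounding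
    -- for the lost root.
    ... | roots , leaves = +-mono-≤ leaves (⌊n/2⌋-mono roots)

    slot-free-bound : missing root D ≤ 3 + missing root D′ → missing leaf D ≤ missing leaf D′ →
                      lowerBound dominator D ≤ suc (lowerBound staller D′)
    slot-free-bound roots leaves =
      ≤-trans (+-mono-≤ leaves (⌊n/2⌋-mono roots)) (≤-reflexive (+-suc _ _))

  dominator-step : ∀ v → G.Move D D′ v → lowerBound dominator D ≤ suc (lowerBound staller D′)
  -- The hub is near no root and no leaf, so neither count drops; the 3 is slack here and attained
  -- only by ports.
  dominator-step {D} {D′} hub m = slot-free-bound {D} {D′}
    (≤-trans (missing-mono root λ j i ∈D′ → [ id , absurd ] (only ∈D′)) (m≤n+m _ 3))
    (leaf-free-move (λ _ _ ()) m)
    where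
    open G.Move m
    absurd : ∀ {j i} {A : Set} → G.Near hub (root j i) → A
    absurd near with near-root hub near
    ... | inj₁ ()
    ... | inj₂ ()
  dominator-step {D} {D′} (port j₀) m = slot-free-bound {D} {D′}
    (missing-drop₃ root j₀ λ j i j≢j₀ ∈D′ →
      [ id , (λ near → contradiction (same near) j≢j₀) ] (only ∈D′))
    (leaf-free-move (λ _ _ ()) m)
    where
    open G.Move m
    same : ∀ {j i} → G.Near (port j₀) (root j i) → j ≡ j₀
    same near with near-root (port j₀) near
    ... | inj₁ refl = refl
    ... | inj₂ ()
  dominator-step (root j i)  m = inSlot-bound is-root m
  dominator-step (leaf j i)  m = inSlot-bound is-leaf m
  dominator-step (spare j i) m = inSlot-bound is-spare m

  spare-step : ∀ {j i} → G.Move D D′ (spare j i) →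
               lowerBound staller D ≤ suc (lowerBound dominator D′)
  spare-step {j = j₀} {i₀} m = ≤-trans
    (+-mono-≤ leaves (⌈n/2⌉-mono (proj₁ (inSlot-step is-spare m)))) (≤-reflexive (+-suc _ _))
    where
    open G.Move m
    absurd : ∀ {j i} {A : Set} → G.Near (spare j₀ i₀) (leaf j i) → A
    absurd near with near-leaf (spare j₀ i₀) near
    ... | inj₁ ()
    ... | inj₂ ()
    leaves = missing-mono leaf λ j i ∈D′ → [ id , absurd ] (only ∈D′)

  -- With all roots dominated, the halved term is already 0 and the move costs at most one leaf.
  leaf-step : ∀ {j i} → missing root D ≡ 0 → G.Move D D′ (leaf j i) →
              lowerBound staller D ≤ suc (lowerBound dominator D′)
  leaf-step no-roots m rewrite no-roots = +-mono-≤ (proj₂ (inSlot-step is-leaf m)) z≤n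

  -- Staller's strategy: the spare of an undominated root while there is one, then an undominated
  -- leaf.
  staller-step : ∀ D → lowerBound staller D ≡ 0 ⊎
    ∃ λ v → Legal G.graph D v × lowerBound staller D ≤ suc (lowerBound dominator (after G.graph D v))
  staller-step D with some-missing? root D
  ... | inj₁ (j , i , ∉D) = inj₂ (encode (spare j i) ,
    G.near⇒legal {D} {spare j i} (inj₂ (inj₁ (inj₂ refl))) ∉D ,
    spare-step {D} (G.move (strictlyInverseˡ (spare j i))))
  ... | inj₂ no-roots with some-missing? leaf D
  ...   | inj₁ (j , i , ∉D) = inj₂ (encode (leaf j i) ,
    G.near⇒legal {D} {leaf j i} (inj₁ refl) ∉D ,
    leaf-step {D} no-roots (G.move (strictlyInverseˡ (leaf j i))))
  -- Hub, ports or spares may still be undominated, but the bound does not count them.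
  ...   | inj₂ no-leaves = inj₁ (cong₂ (λ b a → b + ⌈ a /2⌉) no-leaves no-roots)

  lowerBound-final : ∀ p {D} → (∀ v → v ∈ D) → lowerBound p D ≡ 0
  lowerBound-final dominator full = cong₂ (λ b a → b + ⌊ a /2⌋)
    (missing≡0 leaf λ _ _ → full _) (missing≡0 root λ _ _ → full _)
  lowerBound-final staller   full = cong₂ (λ b a → b + ⌈ a /2⌉)
    (missing≡0 leaf λ _ _ → full _) (missing≡0 root λ _ _ → full _)

  γg-G-≥ : K * 3 + ⌊ K * 3 /2⌋ ≤ γg G.graph
  γg-G-≥ = ≤-trans
    (+-mono-≤ (missing-∅ leaf) (⌊n/2⌋-mono (missing-∅ root)))
    (movesFrom-≥ G.graph lowerBound lowerBound-final
      (λ {D} {v} _ → dominator-step (decode v) (G.move {D} {v} refl)) staller-step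
      (suc m) dominator ∅ (m≤m+n (suc m) _))

  -- Comparing the two bounds

  spanning-tree-gap : ∀ i → i + (1 + (K * 1 + K * 3)) ≤ K * 3 + ⌊ K * 3 /2⌋ →
    ∃ λ (G : Graph (suc m)) → ∃ λ (T : Graph (suc m)) →
    IsSpanningTreeOf T G × (+ γg G - + γg T) ≥ℤ (+ i)
  spanning-tree-gap i bound = G.graph , T.graph , T-spanning ,
    +≤⇒≤- (≤-trans (+-monoʳ-≤ i γg-T-≤) (≤-trans bound γg-G-≥))

-- The bounds differ by `⌊ K * 3 /2⌋ - K - 1`. Taking `K` even makes the halving exact and turns
-- this into `K / 2 - 1`, which is `ℓ` for `K` equal to twice `suc ℓ`.
bounds-differ : ∀ ℓ → let K = suc ℓ + suc ℓ in
                ℓ + (1 + (K * 1 + K * 3)) ≡ K * 3 + ⌊ K * 3 /2⌋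
bounds-differ ℓ = begin
  ℓ + (1 + (K * 1 + K * 3))         ≡⟨ arithmetic ℓ ⟩
  K * 3 + m * 3                     ≡⟨ cong (_+_ (K * 3)) (n≡⌊n+n/2⌋ (m * 3)) ⟩
  K * 3 + ⌊ m * 3 + m * 3 /2⌋       ≡⟨ cong (λ k → K * 3 + ⌊ k /2⌋) (*-distribʳ-+ 3 m m) ⟨
  K * 3 + ⌊ K * 3 /2⌋               ∎
  where
  open ≡-Reasoning
  m = suc ℓ
  K = m + m
  arithmetic : ∀ ℓ → ℓ + (1 + ((suc ℓ + suc ℓ) * 1 + (suc ℓ + suc ℓ) * 3)) ≡
               (suc ℓ + suc ℓ) * 3 + suc ℓ * 3
  arithmetic = solve-∀

theorem4p5 : (ℓ : ℕ) → ℓ ≥ 1 →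
    ∃ λ (n : ℕ) → ∃ λ (G : Graph n) → ∃ λ (T : Graph n) →
    IsSpanningTreeOf T G × (+ γg G - + γg T) ≥ℤ (+ ℓ)
theorem4p5 ℓ _ = _ ,
  Construction.spanning-tree-gap K (vertices K) ℓ (≤-reflexive (bounds-differ ℓ))
  where K = suc ℓ + suc ℓ
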